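{- Let $(P,\omega)$ be a non-empty labeled poset. Then $$e(P,\omega;\lambda)=\lambda\sum_{\emptyset\ne S\in\mathcal I_\omega(P)}(1-\lambda)^{|S|-1}e(P\setminus S,\omega;\lambda)$$ and $$\tilde e(P,\omega;\lambda)=\frac{\lambda}{1-\lambda}\sum_{\emptyset\ne S\in\mathcal I_\omega(P)}\tilde e(P\setminus S,\omega;\lambda).$$
   Context: All posets are finite and $\mathbb N^+=\{1,2,\dots\}$, $[n]=\{1,\dots,n\}$. An ideal of a poset $P$ is a down-closed subset (including $\emptyset$ and $P$). A labeled poset $(P,\omega)$ is a finite poset $P$ with an injective map $\omega:P\to\mathbb N^+$; each subset $S\subseteq P$ carries the induced order and labeling, giving a labeled poset $(S,\omega)$. A subset $S$ is $\omega$-natural if $\omega|_S$ is order-preserving; $\mathcal I_\omega(P)$ is the set of ideals of $P$ that are $\omega$-natural. A map $f:P\to[n]$ is $\omega$-order-preserving if it is order-preserving and $f(x)>f(y)$ whenever $x>y$ in $P$ and $\omega(x)<\omega(y)$. The order polynomial $\Omega(P,\omega;t)$ is the unique polynomial in $t$ whose value at each $n\in\mathbb N^+$ is the number of $\omega$-order-preserving maps $P\to[n]$; $\Omega(\emptyset,\omega;t)=1$. The Eulerian polynomial $e(P,\omega;\lambda)$ and the invariant $\tilde e(P,\omega;\lambda)$ are defined by $$\tilde e(P,\omega;\lambda)=\sum_{n=0}^\infty\Omega(P,\omega;n)\lambda^n=\frac{e(P,\omega;\lambda)}{(1-\lambda)^{|P|+1}} .$$ In particular $e(\emptyset,\omega;\lambda)=1$.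 -}

module Defs where

open import Level using (0ℓ)
open import Data.Bool using (true; false)
open import Data.Nat as ℕ using (ℕ; zero; suc; _∸_; NonZero)
import Data.Nat.Properties as ℕ
open import Data.Integer using (+_)
open import Data.Rational as ℚ using (ℚ; 0ℚ; 1ℚ)
import Data.Rational.Properties as ℚ
open import Data.Fin as Fin using (Fin; zero; suc; toℕ)
import Data.Fin.Properties as Fin
open import Data.Fin.Subset using (Subset; _∈_; ∣_∣; ∁; Nonempty)
open import Data.Fin.Subset.Properties using (_∈?_; nonempty?)
open import Data.List using (List; []; _∷_; map; filter; foldr; length; allFin; cartesianProductWith)
open import Data.Vec as Vec using (Vec; []; _∷_; lookup)
open import Data.Product using (_×_; _,_)
open import Function using (_on_)
open import Relation.Binary using (Rel; IsDecPartialOrder; Decidable)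
import Relation.Binary.Construct.NonStrictToStrict as ToStrict
open import Relation.Binary.PropositionalEquality
open import Relation.Nullary using (Dec)
open import Relation.Nullary.Decidable using (_→-dec_; _×-dec_)
open import Algebra.Properties.Monoid.Sum ℚ.+-0-monoid
  using (sum⁺-syntax; sum-cong-≗; sum-replicate-zero)

-- The ground set is {0, …, size - 1}, so every finite poset occurs up to
-- isomorphism.  Decidability of the order is automatic classically; here it
-- is what makes order-preserving maps and ideals countable.
record LabeledPoset : Set₁ where
  field
    size              : ℕ
    _≤_               : Rel (Fin size) 0ℓ
    isDecPartialOrder : IsDecPartialOrder _≡_ _≤_
    ω                 : Fin size → ℕ
    ω-positive        : ∀ x → NonZero (ω x)
    ω-injective       : ∀ {x y} → ω x ≡ ω y → x ≡ y

  open IsDecPartialOrder isDecPartialOrder public using (_≤?_)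
  open ToStrict _≡_ _≤_ public using (_<_)

  _<?_ : Decidable _<_
  _<?_ = ToStrict.<-decidable _≡_ _≤_ Fin._≟_ _≤?_

open LabeledPoset using (size)

-- The increasing enumeration of the elements of S.
element : ∀ {n} (S : Subset n) → Fin ∣ S ∣ → Fin n
element (true  ∷ S) zero    = zero
element (true  ∷ S) (suc i) = suc (element S i)
element (false ∷ S) i       = suc (element S i)

element-injective : ∀ {n} (S : Subset n) {i j} → element S i ≡ element S j → i ≡ j
element-injective (true  ∷ S) {zero}  {zero}  _  = refl
element-injective (true  ∷ S) {suc i} {suc j} eq =
  cong suc (element-injective S (Fin.suc-injective eq))
element-injective (false ∷ S) eq = element-injective S (Fin.suc-injective eq)

induced : (P : LabeledPoset) → Subset (size P) → LabeledPoset
induced P S = record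
  { size              = ∣ S ∣
  ; _≤_               = _≤_ on element S
  ; isDecPartialOrder = record
    { isPartialOrder = record
      { isPreorder = record
        { isEquivalence = isEquivalence
        ; reflexive     = λ eq → P.reflexive (cong (element S) eq)
        ; trans         = P.trans
        }
      ; antisym = λ x≤y y≤x → element-injective S (P.antisym x≤y y≤x)
      }
    ; _≟_  = Fin._≟_
    ; _≤?_ = λ x y → element S x ≤? element S y
    }
  ; ω           = λ x → ω (element S x)
  ; ω-positive  = λ x → ω-positive (element S x)
  ; ω-injective = λ eq → element-injective S (ω-injective eq)
  }
  where
  open LabeledPoset P
  module P = IsDecPartialOrder isDecPartialOrder

infixl 6 _∖_
_∖_ : (P : LabeledPoset) → Subset (size P) → LabeledPoset
P ∖ S = induced P (∁ S)

vectors : {A : Set} → List A → (m : ℕ) → List (Vec A m)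
vectors xs zero    = [] ∷ []
vectors xs (suc m) = cartesianProductWith _∷_ xs (vectors xs m)

subsets : (m : ℕ) → List (Subset m)
subsets = vectors (true ∷ false ∷ [])

module _ (P : LabeledPoset) where
  open LabeledPoset P using (_≤_; _<_; _≤?_; _<?_; ω)

  IsIdeal : Subset (size P) → Set
  IsIdeal S = ∀ x y → x ≤ y → y ∈ S → x ∈ S

  IsNatural : Subset (size P) → Set
  IsNatural S = ∀ x y → x ∈ S → y ∈ S → x ≤ y → ω x ℕ.≤ ω y

  IsNonemptyNaturalIdeal : Subset (size P) → Set
  IsNonemptyNaturalIdeal S = Nonempty S × IsIdeal S × IsNatural S

  isNonemptyNaturalIdeal? : ∀ S → Dec (IsNonemptyNaturalIdeal S)
  isNonemptyNaturalIdeal? S =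
    nonempty? S
    ×-dec Fin.all? (λ x → Fin.all? λ y →
            (x ≤? y) →-dec (y ∈? S) →-dec (x ∈? S))
    ×-dec Fin.all? (λ x → Fin.all? λ y →
            (x ∈? S) →-dec (y ∈? S) →-dec (x ≤? y) →-dec (ω x ℕ.≤? ω y))

  -- { S ∈ 𝓘_ω(P) ∣ S ≠ ∅ }, each such S listed exactly once.
  nonemptyNaturalIdeals : List (Subset (size P))
  nonemptyNaturalIdeals = filter isNonemptyNaturalIdeal? (subsets (size P))

  -- A map P → [n] is the vector of its values; Fin n stands for [n].
  IsωOrderPreserving : ∀ {n} → Vec (Fin n) (size P) → Set
  IsωOrderPreserving f =
      (∀ x y → x ≤ y → lookup f x Fin.≤ lookup f y)
    × (∀ x y → y < x → ω x ℕ.< ω y → lookup f y Fin.< lookup f x)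

  isωOrderPreserving? : ∀ {n} (f : Vec (Fin n) (size P)) → Dec (IsωOrderPreserving f)
  isωOrderPreserving? f =
    Fin.all? (λ x → Fin.all? λ y →
      (x ≤? y) →-dec (lookup f x Fin.≤? lookup f y))
    ×-dec Fin.all? (λ x → Fin.all? λ y →
      (y <? x) →-dec (ω x ℕ.<? ω y) →-dec (lookup f y Fin.<? lookup f x))

  countMaps : ℕ → ℕ
  countMaps n = length (filter isωOrderPreserving? (vectors (allFin n) (size P)))

fromℕ : ℕ → ℚ
fromℕ n = + n ℚ./ 1

-- Coefficients, constant term first.
Polynomial : Set
Polynomial = List ℚ

eval : Polynomial → ℚ → ℚ
eval p t = foldr (λ a r → a ℚ.+ t ℚ.* r) 0ℚ p

-- This determines p as a polynomial, including its value at 0, which is not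
-- prescribed to be a number of maps.
IsOrderPolynomial : LabeledPoset → Polynomial → Set
IsOrderPolynomial P p =
  ∀ n → .{{NonZero n}} → eval p (fromℕ n) ≡ fromℕ (countMaps P n)

-- Formal power series in λ over ℚ: the value at n is the coefficient of λⁿ.
PowerSeries : Set
PowerSeries = ℕ → ℚ

infix  4 _≈_
infixl 6 _⊕_
infixl 7 _⊗_
infixr 8 _^_

_≈_ : Rel PowerSeries 0ℓ
a ≈ b = ∀ n → a n ≡ b n

𝟘 𝟙 X 1-X 1/[1-X] : PowerSeries
𝟘 _ = 0ℚ

𝟙 zero    = 1ℚ
𝟙 (suc _) = 0ℚ

X 1             = 1ℚ
X zero          = 0ℚ
X (suc (suc _)) = 0ℚ

1-X n = 𝟙 n ℚ.- X n

1/[1-X] _ = 1ℚ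

_⊕_ _⊗_ : PowerSeries → PowerSeries → PowerSeries
(a ⊕ b) n = a n ℚ.+ b n
(a ⊗ b) n = ∑[ i ≤ n ] (a (toℕ i) ℚ.* b (n ∸ toℕ i))

_^_ : PowerSeries → ℕ → PowerSeries
a ^ zero  = 𝟙
a ^ suc k = a ⊗ a ^ k

1-X-inverse : 1-X ⊗ 1/[1-X] ≈ 𝟙
1-X-inverse zero    = refl
1-X-inverse (suc n) =
  cong (λ r → 1ℚ ℚ.+ ((ℚ.- 1ℚ) ℚ.+ r))
    (trans (sum-cong-≗ {n} (λ _ → refl)) (sum-replicate-zero n))

∑ : {A : Set} → List A → (A → PowerSeries) → PowerSeries
∑ xs a = foldr _⊕_ 𝟘 (map a xs)

infix 5 ∑
syntax ∑ xs (λ x → a) = ∑[ x ∈ xs ] a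

-- In the next two definitions Ω assigns to each labeled poset its order
-- polynomial.
ẽ : (LabeledPoset → Polynomial) → LabeledPoset → PowerSeries
ẽ Ω P n = eval (Ω P) (fromℕ n)

-- The defining equation ẽ = e / (1 - λ)^(|P| + 1), solved for e in ℚ[[λ]].
e : (LabeledPoset → Polynomial) → LabeledPoset → PowerSeries
e Ω P = 1-X ^ suc (size P) ⊗ ẽ Ω P

{-# OPTIONS --safe #-}

-- The zero set of an ω-order-preserving map P → [n + 1] (values counted from 0)
-- is an ω-natural ideal S, and the remaining values form an arbitrary
-- ω-order-preserving map P ∖ S → [n].  Separating S = ∅ gives
--   Ω(P; n + 1) - Ω(P; n) = ∑_{S ≠ ∅} Ω(P ∖ S; n),
-- that is, (1 - λ) ẽ(P) = λ ∑_{S ≠ ∅} ẽ(P ∖ S) once Ω(P; 0) = 0 is known.  Both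
-- formulas follow by multiplying with powers of 1 - λ.

module Submission where

open import Defs
open import Algebra.Bundles using (CommutativeSemigroup)
import Algebra.Properties.CommutativeSemigroup as CommutativeSemigroupProperties
import Algebra.Properties.Group as GroupProperties
open import Data.Bool using (true; false; if_then_else_)
open import Data.Empty using (⊥-elim)
open import Data.Fin as Fin using (Fin; zero; suc)
open import Data.Fin.Subset using (Subset; _∈_; ∣_∣; ∁; ⊥)
open import Data.Fin.Subset.Properties using (nonempty?; ∣∁p∣≡n∸∣p∣; ∣p∣≤n)
import Data.Integer as ℤ
import Data.Integer.Properties as ℤ
open import Data.List as List using (List; []; _∷_; map; filter; length; allFin; cartesianProductWith; _++_)
open import Data.List.Properties using (map-tabulate; map-++; map-∘; map-cong)
open import Data.List.Relation.Unary.All as All using (All; []; _∷_)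
open import Data.List.Relation.Unary.All.Properties using (all-filter)
open import Data.Nat as ℕ using (ℕ; zero; suc; _∸_; NonZero; z≤n; s≤s)
open import Data.Nat.Induction using (<-wellFounded)
open import Data.Nat.ListAction using (sum)
open import Data.Nat.ListAction.Properties using (sum-++)
import Data.Nat.Properties as ℕ
open import Data.Product using (∃; _×_; _,_)
open import Data.Rational as ℚ using (ℚ; 0ℚ; 1ℚ; _+_; _*_; _-_; -_)
import Data.Rational.Properties as ℚ
open import Data.Rational.Solver using (module +-*-Solver)
import Data.Rational.Unnormalised as ℚᵘ
import Data.Rational.Unnormalised.Properties as ℚᵘ
open import Data.Vec as Vec using (Vec; []; _∷_; lookup; here; there)
open import Data.Vec.Properties using (lookup-map)
open import Function using (_∘_; _⇔_; mk⇔; Equivalence)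
open import Induction.WellFounded using (Acc; acc)
open import Relation.Binary using (Setoid)
import Relation.Binary.Reasoning.Setoid as SetoidReasoning
open import Relation.Binary.PropositionalEquality
open import Relation.Nullary using (Dec; yes; no; does; ¬_)
open import Relation.Nullary.Decidable using (does-⇔; _×-dec_)
open import Relation.Unary using (Decidable; Pred)

open LabeledPoset using (size)
open ≡-Reasoning
open +-*-Solver using (solve; _:+_; _:*_; _:-_; con; _:=_)

private variable
  A B C : Set

-- Finite sums of natural numbers indexed by lists.

sumOver : List A → (A → ℕ) → ℕ
sumOver xs f = sum (map f xs)

infix 5 sumOver
syntax sumOver xs (λ x → n) = Σ[ x ∈ xs ] n

sumOver-cong : (xs : List A) {f g : A → ℕ} → f ≗ g → sumOver xs f ≡ sumOver xs g
sumOver-cong xs f≗g = cong sum (map-cong f≗g xs)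

sumOver-++ : (xs ys : List A) (f : A → ℕ) → sumOver (xs ++ ys) f ≡ sumOver xs f ℕ.+ sumOver ys f
sumOver-++ xs ys f = trans (cong sum (map-++ f xs ys)) (sum-++ (map f xs) (map f ys))

sumOver-map : (g : A → B) (xs : List A) (f : B → ℕ) → sumOver (map g xs) f ≡ sumOver xs (f ∘ g)
sumOver-map g xs f = cong sum (sym (map-∘ xs))

sumOver-+ : (xs : List A) (f g : A → ℕ) →
            (Σ[ x ∈ xs ] f x ℕ.+ g x) ≡ sumOver xs f ℕ.+ sumOver xs g
sumOver-+ []       f g = refl
sumOver-+ (x ∷ xs) f g = begin
  (f x ℕ.+ g x) ℕ.+ sumOver xs (λ y → f y ℕ.+ g y)    ≡⟨ cong (f x ℕ.+ g x ℕ.+_) (sumOver-+ xs f g) ⟩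
  (f x ℕ.+ g x) ℕ.+ (sumOver xs f ℕ.+ sumOver xs g)   ≡⟨ interchange (f x) (g x) _ _ ⟩
  (f x ℕ.+ sumOver xs f) ℕ.+ (g x ℕ.+ sumOver xs g)   ∎
  where open CommutativeSemigroupProperties ℕ.+-commutativeSemigroup using (interchange)

sumOver-0 : (xs : List A) → (Σ[ x ∈ xs ] 0) ≡ 0
sumOver-0 []       = refl
sumOver-0 (_ ∷ xs) = sumOver-0 xs

sumOver-* : ∀ c (xs : List A) (f : A → ℕ) → (Σ[ x ∈ xs ] c ℕ.* f x) ≡ c ℕ.* sumOver xs f
sumOver-* c []       f = sym (ℕ.*-zeroʳ c)
sumOver-* c (x ∷ xs) f = begin
  c ℕ.* f x ℕ.+ sumOver xs (λ y → c ℕ.* f y)  ≡⟨ cong (c ℕ.* f x ℕ.+_) (sumOver-* c xs f) ⟩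
  c ℕ.* f x ℕ.+ c ℕ.* sumOver xs f            ≡⟨ ℕ.*-distribˡ-+ c (f x) _ ⟨
  c ℕ.* (f x ℕ.+ sumOver xs f)              ∎

sumOver-swap : (xs : List A) (ys : List B) (f : A → B → ℕ) →
               (Σ[ x ∈ xs ] Σ[ y ∈ ys ] f x y) ≡ (Σ[ y ∈ ys ] Σ[ x ∈ xs ] f x y)
sumOver-swap []       ys f = sym (sumOver-0 ys)
sumOver-swap (x ∷ xs) ys f = begin
  sumOver ys (f x) ℕ.+ (Σ[ x ∈ xs ] sumOver ys (f x))
    ≡⟨ cong (sumOver ys (f x) ℕ.+_) (sumOver-swap xs ys f) ⟩
  sumOver ys (f x) ℕ.+ (Σ[ y ∈ ys ] Σ[ x ∈ xs ] f x y)
    ≡⟨ sumOver-+ ys (f x) _ ⟨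
  (Σ[ y ∈ ys ] f x y ℕ.+ (Σ[ x ∈ xs ] f x y)) ∎

sumOver-cartesianProductWith : (g : A → B → C) (xs : List A) (ys : List B) (f : C → ℕ) →
  sumOver (cartesianProductWith g xs ys) f ≡ (Σ[ x ∈ xs ] Σ[ y ∈ ys ] f (g x y))
sumOver-cartesianProductWith g []       ys f = refl
sumOver-cartesianProductWith g (x ∷ xs) ys f = begin
  sumOver (map (g x) ys ++ cartesianProductWith g xs ys) f
    ≡⟨ sumOver-++ (map (g x) ys) _ f ⟩
  sumOver (map (g x) ys) f ℕ.+ sumOver (cartesianProductWith g xs ys) f
    ≡⟨ cong₂ ℕ._+_ (sumOver-map (g x) ys f) (sumOver-cartesianProductWith g xs ys f) ⟩
  sumOver ys (f ∘ g x) ℕ.+ (Σ[ x ∈ xs ] Σ[ y ∈ ys ] f (g x y)) ∎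

-- Counting by 0/1-valued sums: filters become factors, conjunctions become products.

indicator : Dec A → ℕ
indicator a? = if does a? then 1 else 0

indicator-⇔ : A ⇔ B → (a? : Dec A) (b? : Dec B) → indicator a? ≡ indicator b?
indicator-⇔ A⇔B a? b? = cong (if_then 1 else 0) (does-⇔ A⇔B a? b?)

indicator-× : (a? : Dec A) (b? : Dec B) → indicator (a? ×-dec b?) ≡ indicator a? ℕ.* indicator b?
indicator-× a? b? with does a?
... | true  = sym (ℕ.+-identityʳ _)
... | false = refl

length-filter : {P : Pred A _} (P? : Decidable P) (xs : List A) →
                length (filter P? xs) ≡ (Σ[ x ∈ xs ] indicator (P? x))
length-filter P? []       = refl
length-filter P? (x ∷ xs) with does (P? x)
... | true  = cong suc (length-filter P? xs)
... | false = length-filter P? xs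

sumOver-filter : {P : Pred A _} (P? : Decidable P) (xs : List A) (f : A → ℕ) →
                 sumOver (filter P? xs) f ≡ (Σ[ x ∈ xs ] indicator (P? x) ℕ.* f x)
sumOver-filter P? []       f = refl
sumOver-filter P? (x ∷ xs) f with does (P? x)
... | true  = cong₂ ℕ._+_ (sym (ℕ.+-identityʳ (f x))) (sumOver-filter P? xs f)
... | false = sumOver-filter P? xs f

-- Sums over all subsets.

sumOver-subsets : ∀ {m} (f : Subset (suc m) → ℕ) →
  sumOver (subsets (suc m)) f ≡
    sumOver (subsets m) (f ∘ (true ∷_)) ℕ.+ sumOver (subsets m) (f ∘ (false ∷_))
sumOver-subsets {m} f = trans
  (sumOver-cartesianProductWith _∷_ (true ∷ false ∷ []) (subsets m) f)
  (cong (sumOver (subsets m) (f ∘ (true ∷_)) ℕ.+_) (ℕ.+-identityʳ _))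

-- Induction on `m`: a subset that contains the first element is nonempty, so `⊥` arises only from
-- the subsets that omit it, where the induction hypothesis isolates it.
sumOver-subsets-split : ∀ {m} (f : Subset m → ℕ) →
  sumOver (subsets m) f ≡ f ⊥ ℕ.+ (Σ[ S ∈ subsets m ] indicator (nonempty? S) ℕ.* f S)
sumOver-subsets-split {zero}  f = refl
sumOver-subsets-split {suc m} f = begin
  sumOver (subsets (suc m)) f
    ≡⟨ sumOver-subsets f ⟩
  sumOver (subsets m) (f ∘ (true ∷_)) ℕ.+ sumOver (subsets m) (f ∘ (false ∷_))
    ≡⟨ cong₂ ℕ._+_ (sumOver-cong (subsets m) nonempty-true)
         (trans (sumOver-subsets-split (f ∘ (false ∷_)))
           (cong (f ⊥ ℕ.+_) (sumOver-cong (subsets m) nonempty-false))) ⟩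
  s₁ ℕ.+ (f ⊥ ℕ.+ s₂)
    ≡⟨ x∙yz≈y∙xz s₁ (f ⊥) s₂ ⟩
  f ⊥ ℕ.+ (s₁ ℕ.+ s₂)
    ≡⟨ cong (f ⊥ ℕ.+_) (sumOver-subsets h) ⟨
  f ⊥ ℕ.+ sumOver (subsets (suc m)) h ∎
  where
  open CommutativeSemigroupProperties ℕ.+-commutativeSemigroup using (x∙yz≈y∙xz)
  h : Subset (suc m) → ℕ
  h S = indicator (nonempty? S) ℕ.* f S
  s₁ = sumOver (subsets m) (h ∘ (true ∷_))
  s₂ = sumOver (subsets m) (h ∘ (false ∷_))

  nonempty-true : f ∘ (true ∷_) ≗ h ∘ (true ∷_)
  nonempty-true S = sym (ℕ.+-identityʳ _)

  nonempty-false : (λ S → indicator (nonempty? S) ℕ.* f (false ∷ S)) ≗ h ∘ (false ∷_)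
  nonempty-false S = cong (ℕ._* f (false ∷ S)) (indicator-⇔
    (mk⇔ (λ (x , x∈S) → suc x , there x∈S) λ { (suc x , there x∈S) → x , x∈S })
    (nonempty? S) (nonempty? (false ∷ S)))

-- Decomposition of maps into [n + 1] by their zero set.

merge : ∀ {m n} (S : Subset m) → Vec (Fin n) ∣ ∁ S ∣ → Vec (Fin (suc n)) m
merge []          []      = []
merge (true  ∷ S) g       = zero ∷ merge S g
merge (false ∷ S) (j ∷ g) = suc j ∷ merge S g

sumOver-allFin : ∀ n (f : Fin (suc n) → ℕ) →
  sumOver (allFin (suc n)) f ≡ f zero ℕ.+ sumOver (allFin n) (f ∘ suc)
sumOver-allFin n f = cong (f zero ℕ.+_) (begin
  sumOver (List.tabulate suc) f      ≡⟨ cong (λ xs → sumOver xs f) (map-tabulate {n = n} (λ i → i) suc) ⟨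
  sumOver (map suc (allFin n)) f          ≡⟨ sumOver-map suc (allFin n) f ⟩
  sumOver (allFin n) (f ∘ suc)            ∎)

-- Each map is `merge S g` for exactly one pair, `S` being its zero set. Stating this bijection as a
-- reindexing of sums avoids constructing an inverse: induction on `m` sorts by the first value,
-- where zero puts the first element into `S` and a successor leaves it outside.
sumOver-vectors-merge : ∀ {n} m (f : Vec (Fin (suc n)) m → ℕ) →
  sumOver (vectors (allFin (suc n)) m) f ≡
    (Σ[ S ∈ subsets m ] Σ[ g ∈ vectors (allFin n) ∣ ∁ S ∣ ] f (merge S g))
sumOver-vectors-merge         zero    f = sym (ℕ.+-identityʳ _)
sumOver-vectors-merge {n = n} (suc m) f = begin
  sumOver (vectors (allFin (suc n)) (suc m)) f
    ≡⟨ sumOver-cartesianProductWith _∷_ (allFin (suc n)) V f ⟩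
  (Σ[ j ∈ allFin (suc n) ] Σ[ v ∈ V ] f (j ∷ v))
    ≡⟨ sumOver-allFin n _ ⟩
  (Σ[ v ∈ V ] f (zero ∷ v)) ℕ.+ (Σ[ j ∈ allFin n ] Σ[ v ∈ V ] f (suc j ∷ v))
    ≡⟨ cong₂ ℕ._+_ (sumOver-vectors-merge m (f ∘ (zero ∷_)))
         (sumOver-cong (allFin n) λ j → sumOver-vectors-merge m (f ∘ (suc j ∷_))) ⟩
  F₁ ℕ.+ (Σ[ j ∈ allFin n ] Σ[ S ∈ subsets m ] Σ[ g ∈ W S ] f (suc j ∷ merge S g))
    -- With the sum over `S` outermost, the first value `j` can be joined to `g`, giving one vector
    -- on the complement of `false ∷ S`.
    ≡⟨ cong (F₁ ℕ.+_) (sumOver-swap (allFin n) (subsets m) _) ⟩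
  F₁ ℕ.+ (Σ[ S ∈ subsets m ] Σ[ j ∈ allFin n ] Σ[ g ∈ W S ] f (suc j ∷ merge S g))
    ≡⟨ cong (F₁ ℕ.+_) (sumOver-cong (subsets m) λ S →
         sym (sumOver-cartesianProductWith _∷_ (allFin n) (W S) (f ∘ merge (false ∷ S)))) ⟩
  F₁ ℕ.+ (Σ[ S ∈ subsets m ] Σ[ g ∈ vectors (allFin n) ∣ ∁ (false ∷ S) ∣ ] f (merge (false ∷ S) g))
    ≡⟨ sumOver-subsets (λ S → Σ[ g ∈ vectors (allFin n) ∣ ∁ S ∣ ] f (merge S g)) ⟨
  (Σ[ S ∈ subsets (suc m) ] Σ[ g ∈ vectors (allFin n) ∣ ∁ S ∣ ] f (merge S g)) ∎
  where
  V = vectors (allFin (suc n)) m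
  W : (S : Subset m) → List (Vec (Fin n) ∣ ∁ S ∣)
  W S = vectors (allFin n) ∣ ∁ S ∣
  F₁ = Σ[ S ∈ subsets m ] Σ[ g ∈ W S ] f (zero ∷ merge S g)

-- For variable `m` the length `∣ ∁ ⊥ ∣` is equal to `m` but does not reduce to it, so the vectors
-- on the two sides have different types; comparing sums avoids a transport.
sumOver-vectors-merge-⊥ : ∀ {n} m (xs : List (Fin n)) (f : Vec (Fin (suc n)) m → ℕ) →
  (Σ[ g ∈ vectors xs ∣ ∁ (⊥ {m}) ∣ ] f (merge ⊥ g)) ≡ (Σ[ g ∈ vectors xs m ] f (Vec.map suc g))
sumOver-vectors-merge-⊥ zero    xs f = refl
sumOver-vectors-merge-⊥ (suc m) xs f = begin
  (Σ[ g ∈ vectors xs ∣ ∁ (⊥ {suc m}) ∣ ] f (merge ⊥ g))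
    ≡⟨ sumOver-cartesianProductWith _∷_ xs (vectors xs ∣ ∁ (⊥ {m}) ∣) _ ⟩
  (Σ[ j ∈ xs ] Σ[ g ∈ vectors xs ∣ ∁ (⊥ {m}) ∣ ] f (suc j ∷ merge ⊥ g))
    ≡⟨ sumOver-cong xs (λ j → sumOver-vectors-merge-⊥ m xs (f ∘ (suc j ∷_))) ⟩
  (Σ[ j ∈ xs ] Σ[ g ∈ vectors xs m ] f (suc j ∷ Vec.map suc g))
    ≡⟨ sumOver-cartesianProductWith _∷_ xs (vectors xs m) _ ⟨
  (Σ[ g ∈ vectors xs (suc m) ] f (Vec.map suc g)) ∎

lookup-merge-∈ : ∀ {m n} (S : Subset m) (g : Vec (Fin n) ∣ ∁ S ∣) {x} →
                 x ∈ S → lookup (merge S g) x ≡ zero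
lookup-merge-∈ (true  ∷ S) g       here        = refl
lookup-merge-∈ (true  ∷ S) g       (there x∈S) = lookup-merge-∈ S g x∈S
lookup-merge-∈ (false ∷ S) (_ ∷ g) (there x∈S) = lookup-merge-∈ S g x∈S

lookup-merge-element : ∀ {m n} (S : Subset m) (g : Vec (Fin n) ∣ ∁ S ∣) i →
                       lookup (merge S g) (element (∁ S) i) ≡ suc (lookup g i)
lookup-merge-element (true  ∷ S) g       i       = lookup-merge-element S g i
lookup-merge-element (false ∷ S) (_ ∷ g) zero    = refl
lookup-merge-element (false ∷ S) (_ ∷ g) (suc i) = lookup-merge-element S g i

-- An outside element is presented by its index in the complement, so that a match puts it into the
-- form `element (∁ S) i` on which `lookup-merge-element` applies.
data Position {m} (S : Subset m) : Fin m → Set where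
  inside  : ∀ {x} → x ∈ S → Position S x
  outside : ∀ i → Position S (element (∁ S) i)

position : ∀ {m} (S : Subset m) x → Position S x
position (true  ∷ S) zero    = inside here
position (false ∷ S) zero    = outside zero
position (true  ∷ S) (suc x) with position S x
... | inside x∈S = inside (there x∈S)
... | outside i  = outside i
position (false ∷ S) (suc x) with position S x
... | inside x∈S = inside (there x∈S)
... | outside i  = outside (suc i)

-- Order preservation under the decomposition, and the recursion for the numbers of maps.

module _ (P : LabeledPoset) {n : ℕ} where
  open LabeledPoset P using (_≤_; _<_; ω)

  private module _ (S : Subset (size P)) (g : Vec (Fin n) ∣ ∁ S ∣) where

    f : Vec (Fin (suc n)) (size P)
    f = merge S g

    -- The value at `y` is 0, while values outside `S` are successors.
    f≤⇒∈ : ∀ {x y} → lookup f x Fin.≤ lookup f y → y ∈ S → x ∈ S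
    f≤⇒∈ {x} fx≤fy y∈S with position S x
    ... | inside x∈S = x∈S
    ... | outside i  with subst₂ Fin._≤_ (lookup-merge-element S g i) (lookup-merge-∈ S g y∈S) fx≤fy
    ...   | ()

    ≮-on-S : ∀ {x y} → x ∈ S → y ∈ S → ¬ lookup f x Fin.< lookup f y
    ≮-on-S x∈S y∈S fx<fy
      with () ← subst₂ Fin._<_ (lookup-merge-∈ S g x∈S) (lookup-merge-∈ S g y∈S) fx<fy

    to : IsωOrderPreserving P f → IsIdeal P S × IsNatural P S × IsωOrderPreserving (P ∖ S) g
    to (mono , strict) = ideal , natural , mono′ , strict′
      where
      ideal : IsIdeal P S
      ideal x y x≤y = f≤⇒∈ (mono x y x≤y)

      natural : IsNatural P S
      natural x y x∈S y∈S x≤y with ω x ℕ.≤? ω y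
      ... | yes ωx≤ωy = ωx≤ωy
      -- A descent of ω within `S` would force a strict inequality between two values that are both
      -- 0; `x` and `y` differ because their labels do.
      ... | no  ωx≰ωy = ⊥-elim (≮-on-S x∈S y∈S
        (strict y x (x≤y , λ { refl → ωx≰ωy ℕ.≤-refl }) (ℕ.≰⇒> ωx≰ωy)))

      mono′ : ∀ i j → element (∁ S) i ≤ element (∁ S) j → lookup g i Fin.≤ lookup g j
      mono′ i j i≤j = ℕ.s≤s⁻¹ (subst₂ Fin._≤_
        (lookup-merge-element S g i) (lookup-merge-element S g j) (mono _ _ i≤j))

      strict′ : ∀ i j → LabeledPoset._<_ (P ∖ S) j i →
                ω (element (∁ S) i) ℕ.< ω (element (∁ S) j) → lookup g j Fin.< lookup g i
      strict′ i j (j≤i , j≢i) ωi<ωj = ℕ.s≤s⁻¹ (subst₂ Fin._<_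
        (lookup-merge-element S g j) (lookup-merge-element S g i)
        (strict _ _ (j≤i , j≢i ∘ element-injective (∁ S)) ωi<ωj))

    from : IsIdeal P S × IsNatural P S × IsωOrderPreserving (P ∖ S) g → IsωOrderPreserving P f
    from (ideal , natural , mono , strict) = mono′ , strict′
      where
      mono′ : ∀ x y → x ≤ y → lookup f x Fin.≤ lookup f y
      mono′ x y x≤y with position S x | position S y
      ... | inside x∈S | _          rewrite lookup-merge-∈ S g x∈S = z≤n
      -- This case cannot occur, but no contradiction has to be derived: the ideal property puts `x`
      -- into `S`, so its value rewrites to 0.
      ... | outside i  | inside y∈S
        rewrite lookup-merge-∈ S g (ideal _ _ x≤y y∈S) = z≤n
      ... | outside i  | outside j
        rewrite lookup-merge-element S g i | lookup-merge-element S g j = s≤s (mono i j x≤y)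

      strict′ : ∀ x y → y < x → ω x ℕ.< ω y → lookup f y Fin.< lookup f x
      strict′ x y (y≤x , y≢x) ωx<ωy with position S y | position S x
      ... | outside j  | outside i
        rewrite lookup-merge-element S g i | lookup-merge-element S g j =
        s≤s (strict i j (y≤x , y≢x ∘ cong (element (∁ S))) ωx<ωy)
      ... | inside y∈S | outside i
        rewrite lookup-merge-∈ S g y∈S | lookup-merge-element S g i = s≤s z≤n
      -- The ideal property puts `y` into `S` too, and naturality on `S` then contradicts the
      -- descent of labels.
      ... | _          | inside x∈S =
        ⊥-elim (ℕ.<⇒≱ ωx<ωy (natural y x (ideal y x y≤x x∈S) x∈S y≤x))

  -- Comparable pairs are sorted by their position. Both in `S`: the values are equal, so no
  -- strictness may be required, which is naturality. Only the larger in `S`: excluded, which is the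
  -- ideal property. Only the smaller in `S`: the values increase strictly in any case. Both
  -- outside: the condition on `g`.
  merge-ωOrderPreserving : (S : Subset (size P)) (g : Vec (Fin n) ∣ ∁ S ∣) →
    IsωOrderPreserving P (merge S g) ⇔ (IsIdeal P S × IsNatural P S × IsωOrderPreserving (P ∖ S) g)
  merge-ωOrderPreserving S g = mk⇔ (to S g) (from S g)

  -- Serves the term of the empty zero set, which is to be counted on `P` itself and not on the
  -- induced poset on the complement of `⊥`.
  suc-ωOrderPreserving : (g : Vec (Fin n) (size P)) →
    IsωOrderPreserving P (Vec.map suc g) ⇔ IsωOrderPreserving P g
  suc-ωOrderPreserving g = mk⇔
    (λ (mono , strict) →
        (λ x y x≤y → ℕ.s≤s⁻¹ (subst₂ Fin._≤_ (eq x) (eq y) (mono x y x≤y)))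
      , (λ x y y<x lt → ℕ.s≤s⁻¹ (subst₂ Fin._<_ (eq y) (eq x) (strict x y y<x lt))))
    (λ (mono , strict) →
        (λ x y x≤y → subst₂ Fin._≤_ (sym (eq x)) (sym (eq y)) (s≤s (mono x y x≤y)))
      , (λ x y y<x lt → subst₂ Fin._<_ (sym (eq y)) (sym (eq x)) (s≤s (strict x y y<x lt))))
    where
    eq : ∀ x → lookup (Vec.map Fin.suc g) x ≡ suc (lookup g x)
    eq x = lookup-map x suc g

-- The case `n = 0` is included, and `ẽ-zero` depends on it.
countMaps-suc : ∀ P n →
  countMaps P (suc n) ≡ countMaps P n ℕ.+ (Σ[ S ∈ nonemptyNaturalIdeals P ] countMaps (P ∖ S) n)
countMaps-suc P n = begin
  countMaps P (suc n)
    ≡⟨ length-filter (isωOrderPreserving? P) (vectors (allFin (suc n)) m) ⟩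
  (Σ[ f ∈ vectors (allFin (suc n)) m ] [P] f)
    ≡⟨ sumOver-vectors-merge m [P] ⟩
  (Σ[ S ∈ subsets m ] mergeable S)
    ≡⟨ sumOver-subsets-split mergeable ⟩
  mergeable ⊥ ℕ.+ (Σ[ S ∈ subsets m ] indicator (nonempty? S) ℕ.* mergeable S)
    ≡⟨ cong₂ ℕ._+_ empty (trans (sumOver-cong (subsets m) nonempty)
         (sym (sumOver-filter (isNonemptyNaturalIdeal? P) (subsets m) _))) ⟩
  countMaps P n ℕ.+ (Σ[ S ∈ nonemptyNaturalIdeals P ] countMaps (P ∖ S) n) ∎
  where
  m = size P

  [P] : ∀ {k} → Vec (Fin k) m → ℕ
  [P] f = indicator (isωOrderPreserving? P f)

  mergeable : Subset m → ℕ
  mergeable S = Σ[ g ∈ vectors (allFin n) ∣ ∁ S ∣ ] [P] (merge S g)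

  empty : mergeable ⊥ ≡ countMaps P n
  empty = begin
    mergeable ⊥
      ≡⟨ sumOver-vectors-merge-⊥ m (allFin n) [P] ⟩
    (Σ[ g ∈ vectors (allFin n) m ] [P] (Vec.map suc g))
      ≡⟨ sumOver-cong (vectors (allFin n) m) (λ g →
           indicator-⇔ (suc-ωOrderPreserving P g) (isωOrderPreserving? P (Vec.map suc g)) (isωOrderPreserving? P g)) ⟩
    (Σ[ g ∈ vectors (allFin n) m ] [P] g)
      ≡⟨ length-filter (isωOrderPreserving? P) (vectors (allFin n) m) ⟨
    countMaps P n ∎

  nonempty : ∀ S → indicator (nonempty? S) ℕ.* mergeable S ≡
                   indicator (isNonemptyNaturalIdeal? P S) ℕ.* countMaps (P ∖ S) n
  nonempty S = begin
    indicator (nonempty? S) ℕ.* mergeable S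
      -- The factor for nonemptiness enters the sum, joins the ideal and naturality conditions
      -- extracted from each `merge S g`, and the combined factor, which is independent of `g`,
      -- leaves the sum again.
      ≡⟨ sumOver-* (indicator (nonempty? S)) V _ ⟨
    (Σ[ g ∈ V ] indicator (nonempty? S) ℕ.* [P] (merge S g))
      ≡⟨ sumOver-cong V (λ g → begin
           indicator (nonempty? S) ℕ.* [P] (merge S g)
             ≡⟨ indicator-× (nonempty? S) (isωOrderPreserving? P (merge S g)) ⟨
           indicator (nonempty? S ×-dec isωOrderPreserving? P (merge S g))
             ≡⟨ indicator-⇔ (mk⇔
                  (λ (ne , op) → let (I , N , op′) = Equivalence.to (merge-ωOrderPreserving P S g) op
                                 in (ne , I , N) , op′)
                  (λ ((ne , I , N) , op) → ne , Equivalence.from (merge-ωOrderPreserving P S g) (I , N , op)))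
                  (nonempty? S ×-dec isωOrderPreserving? P (merge S g))
                  (isNonemptyNaturalIdeal? P S ×-dec isωOrderPreserving? (P ∖ S) g) ⟩
           indicator (isNonemptyNaturalIdeal? P S ×-dec isωOrderPreserving? (P ∖ S) g)
             ≡⟨ indicator-× (isNonemptyNaturalIdeal? P S) (isωOrderPreserving? (P ∖ S) g) ⟩
           indicator (isNonemptyNaturalIdeal? P S) ℕ.* indicator (isωOrderPreserving? (P ∖ S) g) ∎) ⟩
    (Σ[ g ∈ V ] indicator (isNonemptyNaturalIdeal? P S) ℕ.* indicator (isωOrderPreserving? (P ∖ S) g))
      ≡⟨ sumOver-* (indicator (isNonemptyNaturalIdeal? P S)) V _ ⟩
    indicator (isNonemptyNaturalIdeal? P S) ℕ.* (Σ[ g ∈ V ] indicator (isωOrderPreserving? (P ∖ S) g))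
      ≡⟨ cong (indicator (isNonemptyNaturalIdeal? P S) ℕ.*_)
           (length-filter (isωOrderPreserving? (P ∖ S)) V) ⟨
    indicator (isNonemptyNaturalIdeal? P S) ℕ.* countMaps (P ∖ S) n ∎
    where V = vectors (allFin n) ∣ ∁ S ∣

-- Polynomial functions on ℕ, by iterated finite differences.

fromℕ-+ : ∀ m n → fromℕ (m ℕ.+ n) ≡ fromℕ m + fromℕ n
fromℕ-+ m n = begin
  -- The identity is checked between unnormalised fractions with denominator 1 and then carried over
  -- to normalised ones.
  fromℕ (m ℕ.+ n)  ≡⟨ ℚ.fromℚᵘ-cong {q (m ℕ.+ n)} {q m ℚᵘ.+ q n} (ℚᵘ.*≡* (cong (ℤ._* ℤ.+ 1)
                         (sym (cong₂ ℤ._+_ (ℤ.*-identityʳ (ℤ.+ m)) (ℤ.*-identityʳ (ℤ.+ n)))))) ⟩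
  ℚ.fromℚᵘ (q m ℚᵘ.+ q n)  ≡⟨ ℚ.fromℚᵘ-cong (ℚᵘ.+-cong (ℚ.toℚᵘ-fromℚᵘ (q m)) (ℚ.toℚᵘ-fromℚᵘ (q n))) ⟨
  ℚ.fromℚᵘ (ℚ.toℚᵘ (fromℕ m) ℚᵘ.+ ℚ.toℚᵘ (fromℕ n)) ≡⟨ ℚ.fromℚᵘ-cong (ℚ.toℚᵘ-homo-+ (fromℕ m) (fromℕ n)) ⟨
  ℚ.fromℚᵘ (ℚ.toℚᵘ (fromℕ m + fromℕ n)) ≡⟨ ℚ.fromℚᵘ-toℚᵘ _ ⟩
  fromℕ m + fromℕ n  ∎
  where
  q : ℕ → ℚᵘ.ℚᵘ
  q k = ℚᵘ.mkℚᵘ (ℤ.+ k) 0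

Δ : (ℕ → ℚ) → ℕ → ℚ
Δ f n = f (suc n) - f n

-- The functions f : ℕ → ℚ with Δ ^ k f = 0, i.e. the polynomial functions of
-- degree less than k.
DegreeBelow : ℕ → (ℕ → ℚ) → Set
DegreeBelow zero    f = ∀ n → f n ≡ 0ℚ
DegreeBelow (suc k) f = DegreeBelow k (Δ f)

Degree-cong : ∀ k {f g} → f ≗ g → DegreeBelow k f → DegreeBelow k g
Degree-cong zero    f≗g d n = trans (sym (f≗g n)) (d n)
Degree-cong (suc k) f≗g d   = Degree-cong k (λ n → cong₂ _-_ (f≗g (suc n)) (f≗g n)) d

Degree-suc : ∀ k {f} → DegreeBelow k f → DegreeBelow (suc k) f
Degree-suc zero    d n = cong₂ _-_ (d (suc n)) (d n)
Degree-suc (suc k) d   = Degree-suc k d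

Degree-shift : ∀ k {f} → DegreeBelow k f → DegreeBelow k (f ∘ suc)
Degree-shift zero    d   = d ∘ suc
Degree-shift (suc k) d   = Degree-shift k d

Degree-+ : ∀ k {f g} → DegreeBelow k f → DegreeBelow k g → DegreeBelow k (λ n → f n + g n)
Degree-+ zero    d e n = cong₂ _+_ (d n) (e n)
Degree-+ (suc k) {f} {g} d e = Degree-cong k
  (λ n → solve 4 (λ a b c d → (a :- b) :+ (c :- d) := (a :+ c) :- (b :+ d)) refl
    (f (suc n)) (f n) (g (suc n)) (g n))
  (Degree-+ k d e)

Degree-sucⁿ : ∀ j {k f} → DegreeBelow k f → DegreeBelow (j ℕ.+ k) f
Degree-sucⁿ zero            d = d
Degree-sucⁿ (suc j) {k} {f} d = Degree-suc (j ℕ.+ k) {f} (Degree-sucⁿ j d)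

-- Discrete Leibniz rule: Δ(t f(t)) = t Δf(t) + f(t + 1). The induction hypothesis bounds the first
-- summand, invariance under shifts the second.
Degree-fromℕ-* : ∀ k {f} → DegreeBelow k f → DegreeBelow (suc k) (λ n → fromℕ n * f n)
Degree-fromℕ-* zero    {f} d n = begin
  fromℕ (suc n) * f (suc n) - fromℕ n * f n  ≡⟨ cong₂ (λ x y → fromℕ (suc n) * x - fromℕ n * y) (d (suc n)) (d n) ⟩
  fromℕ (suc n) * 0ℚ - fromℕ n * 0ℚ          ≡⟨ cong₂ _-_ (ℚ.*-zeroʳ (fromℕ (suc n))) (ℚ.*-zeroʳ (fromℕ n)) ⟩
  0ℚ                                         ∎
Degree-fromℕ-* (suc k) {f} d = Degree-cong (suc k) (λ n → sym (leibniz n))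
  (Degree-+ (suc k) {λ n → fromℕ n * Δ f n} (Degree-fromℕ-* k d) (Degree-shift (suc k) {f} d))
  where
  leibniz : ∀ n → fromℕ (suc n) * f (suc n) - fromℕ n * f n ≡ fromℕ n * Δ f n + f (suc n)
  leibniz n = begin
    fromℕ (suc n) * f (suc n) - fromℕ n * f n
      ≡⟨ cong (λ t → t * f (suc n) - fromℕ n * f n) (fromℕ-+ 1 n) ⟩
    (1ℚ + fromℕ n) * f (suc n) - fromℕ n * f n
      ≡⟨ solve 3 (λ t x y → (con 1ℚ :+ t) :* x :- t :* y := t :* (x :- y) :+ x) refl
           (fromℕ n) (f (suc n)) (f n) ⟩
    fromℕ n * Δ f n + f (suc n) ∎

-- Extrapolates an identity from the positive integers to 0 without counting roots: f(0) = f(1) -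
-- Δf(0), and the differences again agree at all positive arguments and have a smaller degree bound.
Degree-unique : ∀ k {f g} → DegreeBelow k f → DegreeBelow k g →
                (∀ n → f (suc n) ≡ g (suc n)) → f 0 ≡ g 0
Degree-unique zero            d d′ f≡g = trans (d 0) (sym (d′ 0))
Degree-unique (suc k) {f} {g} d d′ f≡g = begin
  f 0          ≡⟨ x≡y-[y-x] (f 0) (f 1) ⟩
  f 1 - Δ f 0  ≡⟨ cong₂ _-_ (f≡g 0) (Degree-unique k d d′ λ n → cong₂ _-_ (f≡g (suc n)) (f≡g n)) ⟩
  g 1 - Δ g 0  ≡⟨ x≡y-[y-x] (g 0) (g 1) ⟨
  g 0          ∎
  where
  x≡y-[y-x] : ∀ x y → x ≡ y - (y - x)
  x≡y-[y-x] = solve 2 (λ x y → x := y :- (y :- x)) refl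

IsPolynomial : (ℕ → ℚ) → Set
IsPolynomial f = ∃ λ k → DegreeBelow k f

IsPolynomial-+ : ∀ {f g} → IsPolynomial f → IsPolynomial g → IsPolynomial (f ⊕ g)
IsPolynomial-+ {f} {g} (k , d) (l , d′) = k ℕ.+ l ,
  Degree-+ (k ℕ.+ l) {f} {g} (subst (λ j → DegreeBelow j f) (ℕ.+-comm l k) (Degree-sucⁿ l d)) (Degree-sucⁿ k d′)

IsPolynomial-const : ∀ c → IsPolynomial (λ _ → c)
IsPolynomial-const c = 1 , λ _ → ℚ.+-inverseʳ c

IsPolynomial-shift : ∀ {f} → IsPolynomial f → IsPolynomial (f ∘ suc)
IsPolynomial-shift {f} (k , d) = k , Degree-shift k {f} d

-- `eval` is a Horner scheme, so each coefficient costs one multiplication by the argument and one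
-- added constant.
IsPolynomial-eval : ∀ p → IsPolynomial (λ n → eval p (fromℕ n))
IsPolynomial-eval []      = IsPolynomial-const 0ℚ
IsPolynomial-eval (a ∷ p) = IsPolynomial-+ (IsPolynomial-const a)
  (let (k , d) = IsPolynomial-eval p in suc k , Degree-fromℕ-* k {λ n → eval p (fromℕ n)} d)

IsPolynomial-∑ : (xs : List A) {a : A → PowerSeries} →
                 (∀ x → IsPolynomial (a x)) → IsPolynomial (∑ xs a)
IsPolynomial-∑ []       h = IsPolynomial-const 0ℚ
IsPolynomial-∑ (x ∷ xs) h = IsPolynomial-+ (h x) (IsPolynomial-∑ xs h)

IsPolynomial-unique : ∀ {f g} → IsPolynomial f → IsPolynomial g →
                      (∀ n → f (suc n) ≡ g (suc n)) → f 0 ≡ g 0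
IsPolynomial-unique {f} {g} (k , d) (l , d′) = Degree-unique (k ℕ.+ l) {f} {g}
  (subst (λ j → DegreeBelow j f) (ℕ.+-comm l k) (Degree-sucⁿ l d)) (Degree-sucⁿ k d′)

-- The algebra of formal power series.

⊗-cong : ∀ {a a′ b b′} → a ≈ a′ → b ≈ b′ → a ⊗ b ≈ a′ ⊗ b′
⊗-cong a≈a′ b≈b′ zero    = cong (_+ 0ℚ) (cong₂ _*_ (a≈a′ 0) (b≈b′ 0))
-- By computation the sum unfolds to `a 0 * b (suc n) + (a ∘ suc ⊗ b) n`, and at index 0 to
-- `a 0 * b 0 + 0ℚ`. The inductions below rest on this recursion.
⊗-cong a≈a′ b≈b′ (suc n) =
  cong₂ _+_ (cong₂ _*_ (a≈a′ 0) (b≈b′ (suc n))) (⊗-cong (a≈a′ ∘ suc) b≈b′ n)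

⊗-congˡ : ∀ a {b b′} → b ≈ b′ → a ⊗ b ≈ a ⊗ b′
⊗-congˡ a = ⊗-cong {a} (λ _ → refl)

⊗-congʳ : ∀ b {a a′} → a ≈ a′ → a ⊗ b ≈ a′ ⊗ b
⊗-congʳ b a≈a′ = ⊗-cong {b = b} a≈a′ (λ _ → refl)

⊗-scaleˡ : ∀ c a b → (λ n → c * a n) ⊗ b ≈ (λ n → c * (a ⊗ b) n)
⊗-scaleˡ c a b zero    = solve 3 (λ c x y → c :* x :* y :+ con 0ℚ := c :* (x :* y :+ con 0ℚ)) refl c (a 0) (b 0)
⊗-scaleˡ c a b (suc n) = begin
  c * a 0 * b (suc n) + ((λ n → c * a (suc n)) ⊗ b) n  ≡⟨ cong (c * a 0 * b (suc n) +_) (⊗-scaleˡ c (a ∘ suc) b n) ⟩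
  c * a 0 * b (suc n) + c * (a ∘ suc ⊗ b) n
    ≡⟨ solve 4 (λ c x y z → c :* x :* y :+ c :* z := c :* (x :* y :+ z)) refl
         c (a 0) (b (suc n)) ((a ∘ suc ⊗ b) n) ⟩
  c * (a 0 * b (suc n) + (a ∘ suc ⊗ b) n) ∎

⊗-distribʳ : ∀ a b c → (a ⊕ b) ⊗ c ≈ (a ⊗ c) ⊕ (b ⊗ c)
⊗-distribʳ a b c zero    =
  solve 3 (λ x y z → (x :+ y) :* z :+ con 0ℚ := (x :* z :+ con 0ℚ) :+ (y :* z :+ con 0ℚ)) refl (a 0) (b 0) (c 0)
⊗-distribʳ a b c (suc n) = trans
  (cong ((a 0 + b 0) * c (suc n) +_) (⊗-distribʳ (a ∘ suc) (b ∘ suc) c n))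
  (solve 5 (λ x y z u v → (x :+ y) :* z :+ (u :+ v) := (x :* z :+ u) :+ (y :* z :+ v)) refl
    (a 0) (b 0) (c (suc n)) ((a ∘ suc ⊗ c) n) ((b ∘ suc ⊗ c) n))

⊗-zeroˡ : ∀ a → 𝟘 ⊗ a ≈ 𝟘
⊗-zeroˡ a zero    = trans (ℚ.+-identityʳ _) (ℚ.*-zeroˡ (a 0))
⊗-zeroˡ a (suc n) = cong₂ _+_ (ℚ.*-zeroˡ (a (suc n))) (⊗-zeroˡ a n)

⊗-identityˡ : ∀ a → 𝟙 ⊗ a ≈ a
⊗-identityˡ a zero    = trans (ℚ.+-identityʳ _) (ℚ.*-identityˡ (a 0))
⊗-identityˡ a (suc n) =
  trans (cong₂ _+_ (ℚ.*-identityˡ (a (suc n))) (⊗-zeroˡ a n)) (ℚ.+-identityʳ _)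

-- Splits off the last term of the convolution, where the definition splits off the first;
-- commutativity compares the two.
⊗-suc : ∀ a b n → (a ⊗ b) (suc n) ≡ (a ⊗ (b ∘ suc)) n + a (suc n) * b 0
⊗-suc a b zero    = solve 2 (λ x y → x :+ (y :+ con 0ℚ) := x :+ con 0ℚ :+ y) refl (a 0 * b 1) (a 1 * b 0)
⊗-suc a b (suc n) = trans (cong (a 0 * b (suc (suc n)) +_) (⊗-suc (a ∘ suc) b n))
  (sym (ℚ.+-assoc (a 0 * b (suc (suc n))) _ _))

⊗-comm : ∀ a b → a ⊗ b ≈ b ⊗ a
⊗-comm a b zero    = cong (_+ 0ℚ) (ℚ.*-comm (a 0) (b 0))
⊗-comm a b (suc n) = begin
  a 0 * b (suc n) + (a ∘ suc ⊗ b) n    ≡⟨ cong₂ _+_ (ℚ.*-comm (a 0) (b (suc n))) (⊗-comm (a ∘ suc) b n) ⟩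
  b (suc n) * a 0 + (b ⊗ (a ∘ suc)) n  ≡⟨ ℚ.+-comm (b (suc n) * a 0) _ ⟩
  (b ⊗ (a ∘ suc)) n + b (suc n) * a 0  ≡⟨ ⊗-suc b a n ⟨
  (b ⊗ a) (suc n)                      ∎

-- The tail of `a ⊗ b` is `a 0` times the tail of `b` plus `a ∘ suc ⊗ b`, so distributivity and
-- scaling reduce the claim to the induction hypothesis for `a ∘ suc`.
⊗-assoc : ∀ a b c → (a ⊗ b) ⊗ c ≈ a ⊗ (b ⊗ c)
⊗-assoc a b c zero    =
  solve 3 (λ x y z → (x :* y :+ con 0ℚ) :* z :+ con 0ℚ := x :* (y :* z :+ con 0ℚ) :+ con 0ℚ) refl (a 0) (b 0) (c 0)
⊗-assoc a b c (suc n) = begin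
  (a 0 * b 0 + 0ℚ) * c (suc n) + (((λ k → a 0 * b (suc k)) ⊕ (a ∘ suc ⊗ b)) ⊗ c) n
    ≡⟨ cong ((a 0 * b 0 + 0ℚ) * c (suc n) +_) (begin
         (((λ k → a 0 * b (suc k)) ⊕ (a ∘ suc ⊗ b)) ⊗ c) n
           ≡⟨ ⊗-distribʳ (λ k → a 0 * b (suc k)) (a ∘ suc ⊗ b) c n ⟩
         ((λ k → a 0 * b (suc k)) ⊗ c) n + ((a ∘ suc ⊗ b) ⊗ c) n
           ≡⟨ cong₂ _+_ (⊗-scaleˡ (a 0) (b ∘ suc) c n) (⊗-assoc (a ∘ suc) b c n) ⟩
         a 0 * (b ∘ suc ⊗ c) n + (a ∘ suc ⊗ (b ⊗ c)) n ∎) ⟩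
  (a 0 * b 0 + 0ℚ) * c (suc n) + (a 0 * (b ∘ suc ⊗ c) n + (a ∘ suc ⊗ (b ⊗ c)) n)
    ≡⟨ solve 5 (λ x y z u v → (x :* y :+ con 0ℚ) :* z :+ (x :* u :+ v) := x :* (y :* z :+ u) :+ v) refl
         (a 0) (b 0) (c (suc n)) ((b ∘ suc ⊗ c) n) ((a ∘ suc ⊗ (b ⊗ c)) n) ⟩
  a 0 * (b 0 * c (suc n) + (b ∘ suc ⊗ c) n) + (a ∘ suc ⊗ (b ⊗ c)) n ∎

-- Gives access to the library's rearrangements of threefold products.
⊗-semigroup : CommutativeSemigroup _ _
⊗-semigroup = record
  { Carrier = PowerSeries
  ; _≈_     = _≈_
  ; _∙_     = _⊗_
  ; isCommutativeSemigroup = record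
    { isSemigroup = record
      { isMagma = record
        { isEquivalence = Setoid.isEquivalence (ℕ →-setoid ℚ)
        ; ∙-cong        = ⊗-cong
        }
      ; assoc = ⊗-assoc
      }
    ; comm = ⊗-comm
    }
  }

X⊗ : ∀ a n → (X ⊗ a) (suc n) ≡ a n
X⊗ a n = begin
  0ℚ * a (suc n) + (X ∘ suc ⊗ a) n  ≡⟨ cong₂ _+_ (ℚ.*-zeroˡ (a (suc n))) (⊗-congʳ a X∘suc≈𝟙 n) ⟩
  0ℚ + (𝟙 ⊗ a) n                    ≡⟨ ℚ.+-identityˡ _ ⟩
  (𝟙 ⊗ a) n                         ≡⟨ ⊗-identityˡ a n ⟩
  a n                               ∎
  where
  X∘suc≈𝟙 : X ∘ suc ≈ 𝟙
  X∘suc≈𝟙 zero    = refl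
  X∘suc≈𝟙 (suc n) = refl

-- The coefficients of 1 - λ after the first form the constant series -1. This translates difference
-- equations for coefficients into identities of series.
1-X⊗ : ∀ a n → (1-X ⊗ a) (suc n) ≡ Δ a n
1-X⊗ a n = begin
  1ℚ * a (suc n) + (1-X ∘ suc ⊗ a) n  ≡⟨ cong (1ℚ * a (suc n) +_) (⊗-congʳ a 1-X∘suc≈-𝟙 n) ⟩
  1ℚ * a (suc n) + ((λ k → - 1ℚ * 𝟙 k) ⊗ a) n  ≡⟨ cong (1ℚ * a (suc n) +_) (⊗-scaleˡ (- 1ℚ) 𝟙 a n) ⟩
  1ℚ * a (suc n) + - 1ℚ * (𝟙 ⊗ a) n  ≡⟨ cong (λ x → 1ℚ * a (suc n) + - 1ℚ * x) (⊗-identityˡ a n) ⟩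
  1ℚ * a (suc n) + - 1ℚ * a n  ≡⟨ solve 2 (λ x y → con 1ℚ :* x :+ con (- 1ℚ) :* y := x :- y) refl (a (suc n)) (a n) ⟩
  Δ a n  ∎
  where
  1-X∘suc≈-𝟙 : 1-X ∘ suc ≈ (λ k → - 1ℚ * 𝟙 k)
  1-X∘suc≈-𝟙 zero    = refl
  1-X∘suc≈-𝟙 (suc n) = refl

^-+ : ∀ a j k → a ^ (j ℕ.+ k) ≈ a ^ j ⊗ a ^ k
^-+ a zero    k n = sym (⊗-identityˡ (a ^ k) n)
^-+ a (suc j) k n = trans (⊗-congˡ a (^-+ a j k) n) (sym (⊗-assoc a (a ^ j) (a ^ k) n))

∑-cong : {xs : List A} {a b : A → PowerSeries} → All (λ x → a x ≈ b x) xs → ∑ xs a ≈ ∑ xs b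
∑-cong []       n = refl
∑-cong (h ∷ hs) n = cong₂ _+_ (h n) (∑-cong hs n)

⊗-∑ : ∀ a (xs : List A) (b : A → PowerSeries) → a ⊗ ∑ xs b ≈ ∑ xs (λ x → a ⊗ b x)
⊗-∑ a []       b n = trans (⊗-comm a 𝟘 n) (⊗-zeroˡ a n)
⊗-∑ a (x ∷ xs) b n = begin
  (a ⊗ (b x ⊕ ∑ xs b)) n          ≡⟨ ⊗-comm a (b x ⊕ ∑ xs b) n ⟩
  ((b x ⊕ ∑ xs b) ⊗ a) n          ≡⟨ ⊗-distribʳ (b x) (∑ xs b) a n ⟩
  (b x ⊗ a) n + (∑ xs b ⊗ a) n    ≡⟨ cong₂ _+_ (⊗-comm (b x) a n) (trans (⊗-comm (∑ xs b) a n) (⊗-∑ a xs b n)) ⟩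
  (a ⊗ b x) n + (∑ xs (λ x → a ⊗ b x)) n ∎

∑-fromℕ : {xs : List A} {a : A → PowerSeries} {c : A → ℕ} → ∀ n →
          All (λ x → a x n ≡ fromℕ (c x)) xs → ∑ xs a n ≡ fromℕ (sumOver xs c)
∑-fromℕ n []       = refl
∑-fromℕ {xs = x ∷ xs} {c = c} n (h ∷ hs) =
  trans (cong₂ _+_ h (∑-fromℕ n hs)) (sym (fromℕ-+ (c x) (sumOver xs c)))

-- Sizes of subsets and their complements.

x∈S⇒∣S∣>0 : ∀ {m} {S : Subset m} {x} → x ∈ S → NonZero ∣ S ∣
x∈S⇒∣S∣>0 {S = true  ∷ S} _           = _
x∈S⇒∣S∣>0 {S = false ∷ S} (there x∈S) = x∈S⇒∣S∣>0 x∈S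

-- Used twice: the complement is then smaller than `P`, which drives the induction on size, and the
-- exponent |S| - 1 is a genuine difference.
nonemptyNaturalIdeals-nonempty : ∀ P → All (λ S → NonZero ∣ S ∣) (nonemptyNaturalIdeals P)
nonemptyNaturalIdeals-nonempty P = All.map (λ ((_ , x∈S) , _) → x∈S⇒∣S∣>0 x∈S)
  (all-filter (isNonemptyNaturalIdeal? P) (subsets (size P)))

∣∁S∣+∣S∣≡m : ∀ {m} (S : Subset m) → ∣ ∁ S ∣ ℕ.+ ∣ S ∣ ≡ m
∣∁S∣+∣S∣≡m S = trans (cong (ℕ._+ ∣ S ∣) (∣∁p∣≡n∸∣p∣ S)) (ℕ.m∸n+n≡m (∣p∣≤n S))

∣∁S∣<m : ∀ {m} (S : Subset m) → NonZero ∣ S ∣ → ∣ ∁ S ∣ ℕ.< m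
∣∁S∣<m S nz = subst (∣ ∁ S ∣ ℕ.<_) (∣∁S∣+∣S∣≡m S) (ℕ.m<m+n ∣ ∁ S ∣ (ℕ.>-nonZero⁻¹ ∣ S ∣ {{nz}}))

-- Non-emptiness is essential: the empty poset has one map into the empty set.
countMaps-0 : ∀ P → NonZero (size P) → countMaps P 0 ≡ 0
countMaps-0 P nz = cong (length ∘ filter (isωOrderPreserving? P)) (vectors-[] (size P) nz)
  where
  vectors-[] : ∀ m → NonZero m → vectors {Fin 0} [] m ≡ []
  vectors-[] (suc m) _ = refl

-- From numbers of maps to order polynomials and the series ẽ.

module _ (Ω : LabeledPoset → Polynomial) (isΩ : ∀ Q → IsOrderPolynomial Q (Ω Q)) where

  private
    ∑ẽ∖ : LabeledPoset → PowerSeries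
    ∑ẽ∖ P = ∑[ S ∈ nonemptyNaturalIdeals P ] ẽ Ω (P ∖ S)

  -- Agreement of polynomial and count is assumed only for the complements and only at this `n`: at
  -- 0 it is itself what `ẽ-zero` proves by induction on size.
  fromℕ-countMaps-suc : ∀ P n →
    All (λ S → ẽ Ω (P ∖ S) n ≡ fromℕ (countMaps (P ∖ S) n)) (nonemptyNaturalIdeals P) →
    fromℕ (countMaps P (suc n)) ≡ fromℕ (countMaps P n) + ∑ẽ∖ P n
  fromℕ-countMaps-suc P n hs = begin
    fromℕ (countMaps P (suc n))
      ≡⟨ cong fromℕ (countMaps-suc P n) ⟩
    fromℕ (countMaps P n ℕ.+ (Σ[ S ∈ nonemptyNaturalIdeals P ] countMaps (P ∖ S) n))
      ≡⟨ fromℕ-+ (countMaps P n) _ ⟩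
    fromℕ (countMaps P n) + fromℕ (Σ[ S ∈ nonemptyNaturalIdeals P ] countMaps (P ∖ S) n)
      ≡⟨ cong (fromℕ (countMaps P n) +_) (∑-fromℕ n hs) ⟨
    fromℕ (countMaps P n) + ∑ẽ∖ P n ∎

  -- The recursion holds for the polynomial functions at all n ≥ 1, hence also
  -- at n = 0, where it holds for the numbers of maps too.  By induction the
  -- terms of P ∖ S agree in the two recursions, and so does the term of P.
  ẽ-zero : ∀ P → Acc ℕ._<_ (size P) → ẽ Ω P 0 ≡ fromℕ (countMaps P 0)
  ẽ-zero P (acc rs) = ∙-cancelʳ (∑ẽ∖ P 0) (ẽ Ω P 0) (fromℕ (countMaps P 0)) (begin
    ẽ Ω P 0 + ∑ẽ∖ P 0
      ≡⟨ IsPolynomial-unique (IsPolynomial-shift (IsPolynomial-eval (Ω P)))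
           (IsPolynomial-+ (IsPolynomial-eval (Ω P))
             (IsPolynomial-∑ (nonemptyNaturalIdeals P) λ S → IsPolynomial-eval (Ω (P ∖ S))))
           recursion ⟨
    ẽ Ω P 1
      ≡⟨ isΩ P 1 ⟩
    fromℕ (countMaps P 1)
      ≡⟨ fromℕ-countMaps-suc P 0 (All.map (λ {S} nz → ẽ-zero (P ∖ S) (rs (∣∁S∣<m S nz)))
           (nonemptyNaturalIdeals-nonempty P)) ⟩
    fromℕ (countMaps P 0) + ∑ẽ∖ P 0 ∎)
    where
    open GroupProperties ℚ.+-0-group using (∙-cancelʳ)

    recursion : ∀ n → ẽ Ω P (2 ℕ.+ n) ≡ ẽ Ω P (suc n) + ∑ẽ∖ P (suc n)
    recursion n = begin
      ẽ Ω P (2 ℕ.+ n)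
        ≡⟨ isΩ P (2 ℕ.+ n) ⟩
      fromℕ (countMaps P (2 ℕ.+ n))
        ≡⟨ fromℕ-countMaps-suc P (suc n)
             (All.universal (λ S → isΩ (P ∖ S) (suc n)) (nonemptyNaturalIdeals P)) ⟩
      fromℕ (countMaps P (suc n)) + ∑ẽ∖ P (suc n)
        ≡⟨ cong (_+ ∑ẽ∖ P (suc n)) (isΩ P (suc n)) ⟨
      ẽ Ω P (suc n) + ∑ẽ∖ P (suc n) ∎

  ẽ≡countMaps : ∀ P n → ẽ Ω P n ≡ fromℕ (countMaps P n)
  ẽ≡countMaps P zero    = ẽ-zero P (<-wellFounded (size P))
  ẽ≡countMaps P (suc n) = isΩ P (suc n)

  [1-X]⊗ẽ : ∀ P → NonZero (size P) → 1-X ⊗ ẽ Ω P ≈ X ⊗ ∑ẽ∖ P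
  -- A multiple of λ has no constant term, so the order polynomial must vanish at 0.
  [1-X]⊗ẽ P nz zero    = begin
    1ℚ * ẽ Ω P 0 + 0ℚ    ≡⟨ cong (λ x → 1ℚ * x + 0ℚ) (trans (ẽ≡countMaps P 0) (cong fromℕ (countMaps-0 P nz))) ⟩
    0ℚ                   ≡⟨ cong (_+ 0ℚ) (ℚ.*-zeroˡ (∑ẽ∖ P 0)) ⟨
    0ℚ * ∑ẽ∖ P 0 + 0ℚ    ∎
  [1-X]⊗ẽ P nz (suc n) = begin
    (1-X ⊗ ẽ Ω P) (suc n)
      ≡⟨ 1-X⊗ (ẽ Ω P) n ⟩
    ẽ Ω P (suc n) - ẽ Ω P n
      ≡⟨ cong (_- ẽ Ω P n) (begin
           ẽ Ω P (suc n)
             ≡⟨ isΩ P (suc n) ⟩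
           fromℕ (countMaps P (suc n))
             ≡⟨ fromℕ-countMaps-suc P n
                  (All.universal (λ S → ẽ≡countMaps (P ∖ S) n) (nonemptyNaturalIdeals P)) ⟩
           fromℕ (countMaps P n) + ∑ẽ∖ P n
             ≡⟨ cong (_+ ∑ẽ∖ P n) (ẽ≡countMaps P n) ⟨
           ẽ Ω P n + ∑ẽ∖ P n ∎) ⟩
    (ẽ Ω P n + ∑ẽ∖ P n) - ẽ Ω P n
      ≡⟨ solve 2 (λ x y → x :+ y :- x := y) refl (ẽ Ω P n) (∑ẽ∖ P n) ⟩
    ∑ẽ∖ P n
      ≡⟨ X⊗ (∑ẽ∖ P) n ⟨
    (X ⊗ ∑ẽ∖ P) (suc n) ∎

-- Powers of 1 - λ and the two formulas.

exponents : ∀ {m} (S : Subset m) → NonZero ∣ S ∣ → (∣ S ∣ ∸ 1) ℕ.+ suc ∣ ∁ S ∣ ≡ m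
exponents {m} S nz = begin
  (∣ S ∣ ∸ 1) ℕ.+ suc ∣ ∁ S ∣  ≡⟨ ℕ.+-suc (∣ S ∣ ∸ 1) ∣ ∁ S ∣ ⟩
  suc (∣ S ∣ ∸ 1) ℕ.+ ∣ ∁ S ∣  ≡⟨ cong (ℕ._+ ∣ ∁ S ∣) (ℕ.suc-pred ∣ S ∣ {{nz}}) ⟩
  ∣ S ∣ ℕ.+ ∣ ∁ S ∣            ≡⟨ ℕ.+-comm ∣ S ∣ ∣ ∁ S ∣ ⟩
  ∣ ∁ S ∣ ℕ.+ ∣ S ∣            ≡⟨ ∣∁S∣+∣S∣≡m S ⟩
  m                            ∎

theorem2p17 : (Ω : LabeledPoset → Polynomial) → (∀ Q → IsOrderPolynomial Q (Ω Q)) →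
    (P : LabeledPoset) → NonZero (LabeledPoset.size P) →
    (e Ω P ≈ X ⊗ (∑[ S ∈ nonemptyNaturalIdeals P ] (1-X ^ (∣ S ∣ ∸ 1) ⊗ e Ω (P ∖ S))))
    × (ẽ Ω P ≈ (X ⊗ 1/[1-X]) ⊗ (∑[ S ∈ nonemptyNaturalIdeals P ] ẽ Ω (P ∖ S)))
theorem2p17 Ω isΩ P nz = e-recursion , ẽ-recursion
  where
  open SetoidReasoning (ℕ →-setoid ℚ) renaming (begin_ to ≈-begin_; _∎ to _≈-∎)
  open CommutativeSemigroupProperties ⊗-semigroup using (x∙yz≈y∙xz; xy∙z≈y∙xz)

  Is = nonemptyNaturalIdeals P

  T = ∑[ S ∈ Is ] ẽ Ω (P ∖ S)

  summand : ∀ S → NonZero ∣ S ∣ →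
            1-X ^ size P ⊗ ẽ Ω (P ∖ S) ≈ 1-X ^ (∣ S ∣ ∸ 1) ⊗ e Ω (P ∖ S)
  summand S S≢⊥ = ≈-begin
    1-X ^ size P ⊗ ẽ Ω (P ∖ S)
      -- The exponent |P| splits into the |S| - 1 of the formula and the size of the complement plus
      -- one, which is the exponent in the definition of `e` there.
      ≈⟨ ⊗-congʳ (ẽ Ω (P ∖ S)) (λ n → cong (λ k → (1-X ^ k) n) (sym (exponents S S≢⊥))) ⟩
    1-X ^ ((∣ S ∣ ∸ 1) ℕ.+ suc ∣ ∁ S ∣) ⊗ ẽ Ω (P ∖ S)
      ≈⟨ ⊗-congʳ (ẽ Ω (P ∖ S)) (^-+ 1-X (∣ S ∣ ∸ 1) (suc ∣ ∁ S ∣)) ⟩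
    (1-X ^ (∣ S ∣ ∸ 1) ⊗ 1-X ^ suc ∣ ∁ S ∣) ⊗ ẽ Ω (P ∖ S)
      ≈⟨ ⊗-assoc (1-X ^ (∣ S ∣ ∸ 1)) (1-X ^ suc ∣ ∁ S ∣) (ẽ Ω (P ∖ S)) ⟩
    1-X ^ (∣ S ∣ ∸ 1) ⊗ e Ω (P ∖ S) ≈-∎

  e-recursion : e Ω P ≈ X ⊗ (∑[ S ∈ Is ] (1-X ^ (∣ S ∣ ∸ 1) ⊗ e Ω (P ∖ S)))
  e-recursion = ≈-begin
    -- One of the |P| + 1 factors 1 - λ is spent on the recursion for ẽ; the other |P| are
    -- distributed over the sum.
    (1-X ⊗ 1-X ^ size P) ⊗ ẽ Ω P
      ≈⟨ xy∙z≈y∙xz 1-X (1-X ^ size P) (ẽ Ω P) ⟩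
    1-X ^ size P ⊗ (1-X ⊗ ẽ Ω P)
      ≈⟨ ⊗-congˡ (1-X ^ size P) ([1-X]⊗ẽ Ω isΩ P nz) ⟩
    1-X ^ size P ⊗ (X ⊗ T)
      ≈⟨ x∙yz≈y∙xz (1-X ^ size P) X T ⟩
    X ⊗ (1-X ^ size P ⊗ T)
      ≈⟨ ⊗-congˡ X (⊗-∑ (1-X ^ size P) Is (λ S → ẽ Ω (P ∖ S))) ⟩
    X ⊗ (∑[ S ∈ Is ] (1-X ^ size P ⊗ ẽ Ω (P ∖ S)))
      ≈⟨ ⊗-congˡ X (∑-cong (All.map (λ {S} → summand S) (nonemptyNaturalIdeals-nonempty P))) ⟩
    X ⊗ (∑[ S ∈ Is ] (1-X ^ (∣ S ∣ ∸ 1) ⊗ e Ω (P ∖ S))) ≈-∎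

  ẽ-recursion : ẽ Ω P ≈ (X ⊗ 1/[1-X]) ⊗ T
  ẽ-recursion = ≈-begin
    ẽ Ω P
      ≈⟨ ⊗-identityˡ (ẽ Ω P) ⟨
    𝟙 ⊗ ẽ Ω P
      -- Inserting 1 as (1 - λ) times its inverse makes the product (1 - λ) ẽ appear, to which the
      -- recursion applies.
      ≈⟨ ⊗-congʳ (ẽ Ω P) 1-X-inverse ⟨
    (1-X ⊗ 1/[1-X]) ⊗ ẽ Ω P
      ≈⟨ xy∙z≈y∙xz 1-X 1/[1-X] (ẽ Ω P) ⟩
    1/[1-X] ⊗ (1-X ⊗ ẽ Ω P)
      ≈⟨ ⊗-congˡ 1/[1-X] ([1-X]⊗ẽ Ω isΩ P nz) ⟩
    1/[1-X] ⊗ (X ⊗ T)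
      ≈⟨ xy∙z≈y∙xz X 1/[1-X] T ⟨
    (X ⊗ 1/[1-X]) ⊗ T ≈-∎
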